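{- Let $G$ be a finite graph such that $\max(\alpha_M(G),\omega_M(G))=2^k$ for some integer $k\geq 1$. Then $p(G)=k+1$ if and only if $\iota(G)=2^k$ or $\iota(\overline{G})=2^k$.
   Context: Graphs are finite, simple and undirected; $\overline{G}$ denotes the complement of $G$, and $\iota(G)$ denotes the number of isolated vertices of $G$. For $W\subseteq V(G)$, $G[W]$ is the induced subgraph. A subset $M\subseteq V(G)$ is a module of $G$ if every $v\in V(G)\setminus M$ is adjacent either to all vertices of $M$ or to none of them; the modules $\emptyset$, $V(G)$ and the singletons are trivial. A graph $G$ is prime if $|V(G)|\geq 4$ and all its modules are trivial. An extension of $G$ is a graph $H$ with $V(H)\supseteq V(G)$ and $H[V(G)]=G$; a $p$-extension is an extension with $|V(H)\setminus V(G)|=p$. The prime bound $p(G)$ is the smallest integer $p\ge 0$ such that $G$ admits a prime $p$-extension (such extensions exist whenever $|V(G)|\ge 2$). The modular clique number $\omega_M(G)$ is the largest size of a module of $G$ that is a clique in $G$; the modular stability number $\alpha_M(G)$ is the largest size of a module of $G$ that is a stable set in $G$. -}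

module Defs where

open import Data.Nat using (ℕ; zero; suc; _+_; _≤_; _<_)
open import Data.Bool using (Bool; true; false; not; _∧_; if_then_else_)
open import Data.Fin using (Fin; _↑ˡ_; _≟_)
open import Data.Fin.Subset using (Subset; _∈_; _∉_; ∣_∣; ⁅_⁆) renaming (⊥ to ∅ˢ; ⊤ to fullˢ)
open import Data.List using (List; map; allFin; and)
open import Data.Nat.ListAction using (sum)
open import Data.Product using (Σ; ∃; _×_; _,_)
open import Data.Sum using (_⊎_)
open import Relation.Nullary using (¬_)
open import Relation.Nullary.Decidable using (⌊_⌋)
open import Relation.Binary.PropositionalEquality using (_≡_; _≢_)

record Graph (n : ℕ) : Set where
  field
    adj    : Fin n → Fin n → Bool
    sym    : ∀ x y → adj x y ≡ adj y x
    irrefl : ∀ x → adj x x ≡ false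
open Graph public

complement : ∀ {n} → Graph n → Graph n
complement {n} G = record { adj = a ; sym = s ; irrefl = i }
  where
  a : Fin n → Fin n → Bool
  a x y = not (adj G x y) ∧ not ⌊ x ≟ y ⌋
  s : ∀ x y → a x y ≡ a y x
  s x y with adj G x y | adj G y x | sym G x y | x ≟ y | y ≟ x
  ... | _ | _ | Relation.Binary.PropositionalEquality.refl | Relation.Nullary.yes _ | Relation.Nullary.yes _ = Relation.Binary.PropositionalEquality.refl
  ... | _ | _ | Relation.Binary.PropositionalEquality.refl | Relation.Nullary.no _ | Relation.Nullary.no _ = Relation.Binary.PropositionalEquality.refl
  ... | _ | _ | Relation.Binary.PropositionalEquality.refl | Relation.Nullary.yes p | Relation.Nullary.no q = Data.Empty.⊥-elim (q (Relation.Binary.PropositionalEquality.sym p))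
    where import Data.Empty
  ... | _ | _ | Relation.Binary.PropositionalEquality.refl | Relation.Nullary.no q | Relation.Nullary.yes p = Data.Empty.⊥-elim (q (Relation.Binary.PropositionalEquality.sym p))
    where import Data.Empty
  i : ∀ x → a x x ≡ false
  i x with adj G x x | x ≟ x
  ... | _ | Relation.Nullary.yes _ = Data.Bool.Properties.∧-zeroʳ _
    where import Data.Bool.Properties
  ... | _ | Relation.Nullary.no ¬p = Data.Empty.⊥-elim (¬p Relation.Binary.PropositionalEquality.refl)
    where import Data.Empty

isIsolatedᵇ : ∀ {n} → Graph n → Fin n → Bool
isIsolatedᵇ {n} G v = and (map (λ u → not (adj G v u)) (allFin n))

ι : ∀ {n} → Graph n → ℕ
ι {n} G = sum (map (λ v → if isIsolatedᵇ G v then 1 else 0) (allFin n))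

IsModule : ∀ {n} → Graph n → Subset n → Set
IsModule G M = ∀ v → v ∉ M → ∀ x y → x ∈ M → y ∈ M → adj G v x ≡ adj G v y

IsTrivialModule : ∀ {n} → Subset n → Set
IsTrivialModule M = (M ≡ ∅ˢ) ⊎ (M ≡ fullˢ) ⊎ (∃ λ x → M ≡ ⁅ x ⁆)

IsPrime : ∀ {n} → Graph n → Set
IsPrime {n} G = (4 ≤ n) × (∀ M → IsModule G M → IsTrivialModule M)

IsClique : ∀ {n} → Graph n → Subset n → Set
IsClique G M = ∀ x y → x ∈ M → y ∈ M → x ≢ y → adj G x y ≡ true

IsStable : ∀ {n} → Graph n → Subset n → Set
IsStable G M = ∀ x y → x ∈ M → y ∈ M → adj G x y ≡ false

IsModularCliqueNumber : ∀ {n} → Graph n → ℕ → Set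
IsModularCliqueNumber G a =
  (∃ λ M → IsModule G M × IsClique G M × ∣ M ∣ ≡ a) ×
  (∀ M → IsModule G M → IsClique G M → ∣ M ∣ ≤ a)

IsModularStabilityNumber : ∀ {n} → Graph n → ℕ → Set
IsModularStabilityNumber G a =
  (∃ λ M → IsModule G M × IsStable G M × ∣ M ∣ ≡ a) ×
  (∀ M → IsModule G M → IsStable G M → ∣ M ∣ ≤ a)

IsExtension : ∀ {n} (p : ℕ) → Graph n → Graph (n + p) → Set
IsExtension {n} p G H = ∀ x y → adj H (x ↑ˡ p) (y ↑ˡ p) ≡ adj G x y

HasPrimeExtension : ∀ {n} → Graph n → ℕ → Set
HasPrimeExtension {n} G p = Σ (Graph (n + p)) λ H → IsExtension p G H × IsPrime H

IsPrimeBound : ∀ {n} → Graph n → ℕ → Set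
IsPrimeBound G m = HasPrimeExtension G m × (∀ p → p < m → ¬ HasPrimeExtension G p)

{-# OPTIONS --safe #-}
module Submission where

-- Call x and y twins if no third vertex separates them. Twinship is an equivalence relation whose classes are the
-- maximal modular cliques and stable sets, and a minimal module with at least two vertices is either a pair of twins
-- or twin-free; the twin-free ones are disjoint from each other and from the nontrivial twin classes.
--
-- If all classes have at most 2 ^ k elements and a stable class C has exactly 2 ^ k, attach k pairwise nonadjacent
-- vertices so that the neighbourhoods in the new part exhaust all subsets over C, are distinct on each twin class and
-- are not constant on any minimal twin-free module. A nontrivial module then contains all new vertices, and a vertex
-- outside it must lie in a class of size 2 ^ k consisting of isolated or of universal vertices. So without such a class
-- there is a prime k-extension. With 2 ^ k isolated vertices, k new vertices have too few nonempty subsets to tell them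
-- apart, while after joining one new vertex to all of them the previous case applies.

open import Defs
open import Data.Bool using (Bool; true; false; not; _xor_; if_then_else_)
open import Data.Bool.Properties using (∧-identityʳ; not-involutive; not-injective) renaming (_≟_ to _≟ᵇ_)
open import Data.Empty using (⊥; ⊥-elim)
open import Data.Fin using (Fin; zero; suc; toℕ; fromℕ<; cast; splitAt; _↑ˡ_; _↑ʳ_; _≟_)
open import Data.Fin.Properties using (any?; all?; ¬∀⟶∃¬; injective⇒≤; fromℕ<-injective; toℕ<n; toℕ-injective; toℕ-↑ˡ; toℕ-cast; cast-is-id; splitAt-↑ˡ; splitAt-↑ʳ; join-splitAt; ↑ˡ-injective)
open import Data.Fin.Subset using (Subset; _∈_; _∉_; _⊆_; ∣_∣; ⁅_⁆; _∩_) renaming (⊤ to fullˢ)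
open import Data.Fin.Subset.Properties using (_∈?_; _⊆?_; anySubset?; ∉⊥; ∈⊤; ∣⊤∣≡n; x∈⁅x⁆; x∈⁅y⁆⇒x≡y; ⊆-antisym; p⊆q⇒∣p∣≤∣q∣; p⊂q⇒∣p∣<∣q∣; x∈p∩q⁺; x∈p∩q⁻)
open import Data.Bool.ListAction using (and)
import Data.List as List
open import Data.List.Properties using (map-tabulate)
open import Data.Nat using (ℕ; zero; suc; pred; _+_; _*_; _≤_; _<_; _^_; _⊔_; ⌊_/2⌋; z≤n; s≤s; _<?_; ≢-nonZero)
open import Data.Nat.Properties using (suc-injective; ≤-refl; ≤-reflexive; ≤-trans; ≤-antisym; ≤-pred; <-≤-trans; ≤-<-trans; <-irrefl; <⇒≱; ≮⇒≥; m≤n+m; +-mono-≤; +-assoc; +-suc; +-cancelˡ-≡; *-cancelˡ-≡; *-cancelˡ-<; *-monoʳ-≤; *-suc; ^-monoʳ-≤; m^n≢0; n<1+n; ⊔-sel; m≤m⊔n; m≤n⊔m; suc-pred; pred-mono-<; pred-injective) renaming (_≟_ to _≟ⁿ_)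
open import Data.Nat.Induction using (<-wellFounded)
open import Data.Nat.ListAction using (sum)
open import Data.Product using (∃; ∃₂; _×_; _,_; proj₁; proj₂)
open import Data.Sum using (_⊎_; inj₁; inj₂; [_,_]′)
open import Data.Vec using (_∷_; tabulate; here; there)
open import Data.Vec.Properties using (lookup∘tabulate; tabulate-cong; lookup⇒[]=; []=⇒lookup)
open import Function using (_∘_; const)
open import Function.Bundles using (_⇔_; mk⇔)
open import Induction.WellFounded using (Acc; acc)
open import Relation.Binary.PropositionalEquality using (_≡_; _≢_; refl; trans; cong; cong₂; subst; subst₂; ≢-sym; module ≡-Reasoning) renaming (sym to ≡-sym)
open import Relation.Nullary using (¬_; Dec; yes; no; does; contradiction)
open import Relation.Nullary.Decidable using (¬?; _×-dec_; _→-dec_; _⊎-dec_; dec-true; dec-false; decidable-stable)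
open import Relation.Unary using (Pred; Decidable)
open import Level using (0ℓ)

private
  variable
    m n p k : ℕ

-- Finite subsets

⟪_⟫ : {P : Pred (Fin n) 0ℓ} → Decidable P → Subset n
⟪ P? ⟫ = tabulate (does ∘ P?)

∈⟪⟫⁺ : {P : Pred (Fin n) 0ℓ} (P? : Decidable P) {x : Fin n} → P x → x ∈ ⟪ P? ⟫
∈⟪⟫⁺ P? {x} px = lookup⇒[]= x _ (trans (lookup∘tabulate (does ∘ P?) x) (dec-true (P? x) px))

∈⟪⟫⁻ : {P : Pred (Fin n) 0ℓ} (P? : Decidable P) {x : Fin n} → x ∈ ⟪ P? ⟫ → P x
∈⟪⟫⁻ P? {x} x∈ with P? x | trans (≡-sym (lookup∘tabulate (does ∘ P?) x)) ([]=⇒lookup x∈)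
... | yes px | _  = px
... | no _   | ()

rank : Subset n → Fin n → ℕ
rank (b ∷ S) zero    = 0
rank (b ∷ S) (suc x) = (if b then 1 else 0) + rank S x

rank< : (S : Subset n) {x : Fin n} → x ∈ S → rank S x < ∣ S ∣
rank< (true  ∷ S) here        = s≤s z≤n
rank< (true  ∷ S) (there x∈S) = s≤s (rank< S x∈S)
rank< (false ∷ S) (there x∈S) = rank< S x∈S

rank-injective : (S : Subset n) {x y : Fin n} → x ∈ S → y ∈ S → rank S x ≡ rank S y → x ≡ y
rank-injective (true  ∷ S) here      here      e = refl
rank-injective (true  ∷ S) (there a) (there b) e = cong suc (rank-injective S a b (suc-injective e))
rank-injective (false ∷ S) (there a) (there b) e = cong suc (rank-injective S a b e)

rank-surjective : (S : Subset n) {i : ℕ} → i < ∣ S ∣ → ∃ λ x → x ∈ S × rank S x ≡ i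
rank-surjective (true ∷ S) {zero}  i<       = zero , here , refl
rank-surjective (true ∷ S) {suc i} (s≤s i<) with rank-surjective S i<
... | x , x∈S , e = suc x , there x∈S , cong suc e
rank-surjective (false ∷ S) i< with rank-surjective S i<
... | x , x∈S , e = suc x , there x∈S , e

-- `rank` enumerates the members of `S` by `Fin ∣ S ∣`; followed by `f`, this enumeration is an
-- injection into `Fin b`.
∣∣≤ : (S : Subset n) (f : Fin n → ℕ) (b : ℕ) → (∀ {x} → x ∈ S → f x < b) →
      (∀ {x y} → x ∈ S → y ∈ S → f x ≡ f y → x ≡ y) → ∣ S ∣ ≤ b
∣∣≤ S f b f<b f-inj = injective⇒≤ {f = λ i → fromℕ< (f<b (el∈ i))} λ {i} {j} e →
    toℕ-injective (trans (≡-sym (el-rank i)) (trans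
      (cong (rank S) (f-inj (el∈ i) (el∈ j) (fromℕ<-injective _ _ (f<b (el∈ i)) (f<b (el∈ j)) e))) (el-rank j)))
  where
  el : Fin ∣ S ∣ → Fin _
  el i = proj₁ (rank-surjective S (toℕ<n i))
  el∈ : ∀ i → el i ∈ S
  el∈ i = proj₁ (proj₂ (rank-surjective S (toℕ<n i)))
  el-rank : ∀ i → rank S (el i) ≡ toℕ i
  el-rank i = proj₂ (proj₂ (rank-surjective S (toℕ<n i)))

Two : Subset n → Set
Two M = ∃₂ λ x y → x ∈ M × y ∈ M × x ≢ y

two? : (M : Subset n) → Dec (Two M)
two? M = any? λ x → any? λ y → (x ∈? M) ×-dec (y ∈? M) ×-dec ¬? (x ≟ y)

2≤⇒Two : (S : Subset n) → 2 ≤ ∣ S ∣ → Two S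
2≤⇒Two S 2≤ with rank-surjective S (≤-trans (s≤s z≤n) 2≤) | rank-surjective S 2≤
... | x , x∈ , ex | y , y∈ , ey = x , y , x∈ , y∈ , λ { refl → contradiction (trans (≡-sym ex) ey) λ () }

Two⇒other : (S : Subset n) → Two S → ∀ x → ∃ λ y → y ∈ S × y ≢ x
Two⇒other S (a , b , a∈ , b∈ , a≢b) x with a ≟ x
... | yes refl = b , b∈ , ≢-sym a≢b
... | no a≢x   = a , a∈ , a≢x

-- Binary codes of labels

odd : ℕ → Bool
odd zero          = false
odd (suc zero)    = true
odd (suc (suc i)) = odd i

bit : Bool → ℕ
bit b = if b then 1 else 0

odd+2*half : ∀ i → bit (odd i) + 2 * ⌊ i /2⌋ ≡ i
odd+2*half zero          = refl
odd+2*half (suc zero)    = refl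
odd+2*half (suc (suc i)) = begin
  bit (odd i) + 2 * suc ⌊ i /2⌋    ≡⟨ cong (bit (odd i) +_) (*-suc 2 ⌊ i /2⌋) ⟩
  bit (odd i) + (2 + 2 * ⌊ i /2⌋)  ≡⟨ +-suc (bit (odd i)) _ ⟩
  suc (bit (odd i) + (1 + 2 * ⌊ i /2⌋)) ≡⟨ cong suc (+-suc (bit (odd i)) _) ⟩
  suc (suc (bit (odd i) + 2 * ⌊ i /2⌋)) ≡⟨ cong (2 +_) (odd+2*half i) ⟩
  suc (suc i)                      ∎
  where open ≡-Reasoning

odd-bit+2* : ∀ b j → odd (bit b + 2 * j) ≡ b
odd-bit+2* false zero = refl
odd-bit+2* true  zero = refl
odd-bit+2* b (suc j) rewrite *-suc 2 j | +-suc (bit b) (suc (2 * j)) | +-suc (bit b) (2 * j) = odd-bit+2* b j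

-- Little-endian binary value; it identifies the subsets of the k new vertices with the numbers
-- below 2 ^ k.
code : (Fin k → Bool) → ℕ
code {zero}  f = 0
code {suc k} f = bit (f zero) + 2 * code (f ∘ suc)

decode : ℕ → Fin k → Bool
decode i zero    = odd i
decode i (suc q) = decode ⌊ i /2⌋ q

code< : (f : Fin k → Bool) → code f < 2 ^ k
code< {zero}  f = s≤s z≤n
code< {suc k} f = ≤-trans (s≤s (+-mono-≤ (bit≤1 (f zero)) ≤-refl))
  (≤-trans (≤-reflexive (≡-sym (*-suc 2 _))) (*-monoʳ-≤ 2 (code< (f ∘ suc))))
  where
  bit≤1 : ∀ b → bit b ≤ 1
  bit≤1 false = z≤n
  bit≤1 true  = ≤-refl

code-injective : (f g : Fin k → Bool) → code f ≡ code g → ∀ q → f q ≡ g q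
code-injective {suc k} f g e = λ { zero → e₀ ; (suc q) → code-injective (f ∘ suc) (g ∘ suc) e₁ q }
  where
  e₀ : f zero ≡ g zero
  e₀ = trans (≡-sym (odd-bit+2* (f zero) (code (f ∘ suc)))) (trans (cong odd e) (odd-bit+2* (g zero) (code (g ∘ suc))))
  e₁ : code (f ∘ suc) ≡ code (g ∘ suc)
  e₁ = *-cancelˡ-≡ _ _ 2 (+-cancelˡ-≡ (bit (g zero)) _ _
         (trans (cong (λ b → bit b + 2 * code (f ∘ suc)) (≡-sym e₀)) e))

code-false : (f : Fin k → Bool) → (∀ q → f q ≡ false) → code f ≡ 0
code-false {zero}  f h = refl
code-false {suc k} f h rewrite h zero | code-false (f ∘ suc) (h ∘ suc) = refl

code-decode : ∀ k {i} → i < 2 ^ k → code (decode {k} i) ≡ i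
code-decode zero    (s≤s z≤n) = refl
code-decode (suc k) {i} i<    = trans (cong (λ j → bit (odd i) + 2 * j) (code-decode k half<)) (odd+2*half i)
  where
  half< : ⌊ i /2⌋ < 2 ^ k
  half< = *-cancelˡ-< 2 _ _ (≤-<-trans (≤-trans (m≤n+m _ (bit (odd i))) (≤-reflexive (odd+2*half i))) i<)

decode-code : (f : Fin k → Bool) → ∀ q → decode (code f) q ≡ f q
decode-code {k} f = code-injective _ f (code-decode k (code< f))

decode-injective : ∀ k {i j} → i < 2 ^ k → j < 2 ^ k → (∀ q → decode {k} i q ≡ decode j q) → i ≡ j
decode-injective k {i} {j} i< j< h = trans (≡-sym (code-decode k i<)) (trans (code-cong _ _ h) (code-decode k j<))
  where
  code-cong : ∀ {k} (f g : Fin k → Bool) → (∀ q → f q ≡ g q) → code f ≡ code g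
  code-cong {zero}  f g h = refl
  code-cong {suc k} f g h = cong₂ (λ b c → bit b + 2 * c) (h zero) (code-cong (f ∘ suc) (g ∘ suc) (h ∘ suc))

decode-zero⁻¹ : ∀ k {i} → i < 2 ^ k → (∀ q → decode {k} i q ≡ false) → i ≡ 0
decode-zero⁻¹ k i< h = trans (≡-sym (code-decode k i<)) (code-false _ h)

2≤2^ : 1 ≤ k → 2 ≤ 2 ^ k
2≤2^ = ^-monoʳ-≤ 2

-- Modules and twins

¬true⇒false : ∀ {b} → b ≢ true → b ≡ false
¬true⇒false {false} _ = refl
¬true⇒false {true}  h = contradiction refl h

¬false⇒true : ∀ {b} → b ≢ false → b ≡ true
¬false⇒true {true}  _ = refl
¬false⇒true {false} h = contradiction refl h

module-∩ : (G : Graph n) (A B : Subset n) → IsModule G A → IsModule G B → IsModule G (A ∩ B)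
module-∩ G A B mA mB v v∉ x y x∈ y∈ with x∈p∩q⁻ A B x∈ | x∈p∩q⁻ A B y∈ | v ∈? A | v ∈? B
... | xA , xB | yA , yB | no v∉A  | _       = mA v v∉A x y xA yA
... | xA , xB | yA , yB | yes _   | no v∉B  = mB v v∉B x y xB yB
... | xA , xB | yA , yB | yes v∈A | yes v∈B = contradiction (x∈p∩q⁺ (v∈A , v∈B)) v∉

module? : (G : Graph n) (M : Subset n) → Dec (IsModule G M)
module? G M = all? λ v → ¬? (v ∈? M) →-dec all? λ x → all? λ y →
  (x ∈? M) →-dec ((y ∈? M) →-dec (adj G v x ≟ᵇ adj G v y))

prime-intro : (H : Graph m) → 4 ≤ m → (∀ M → IsModule H M → Two M → ∀ x → x ∈ M) → IsPrime H
prime-intro {m} H 4≤m h = 4≤m , trivial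
  where
  trivial : ∀ M → IsModule H M → IsTrivialModule M
  trivial M mM with two? M
  ... | yes two = inj₂ (inj₁ (⊆-antisym (λ _ → ∈⊤) (λ {x} _ → h M mM two x)))
  ... | no ¬two with any? (_∈? M)
  ...   | no ¬any = inj₁ (⊆-antisym (λ {x} x∈ → contradiction (x , x∈) ¬any) (λ x∈ → contradiction x∈ ∉⊥))
  ...   | yes (x , x∈) = inj₂ (inj₂ (x , ⊆-antisym
            (λ {y} y∈ → subst (_∈ ⁅ x ⁆) (decidable-stable (x ≟ y) (λ x≢y → ¬two (x , y , x∈ , y∈ , x≢y))) (x∈⁅x⁆ x))
            (λ {y} y∈ → subst (_∈ M) (≡-sym (x∈⁅y⁆⇒x≡y x y∈)) x∈)))

-- Whether x and y are adjacent to each other is left open, so that pairs in cliques and pairs in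
-- stable sets are treated alike.
Twin : Graph n → Fin n → Fin n → Set
Twin G x y = ∀ v → v ≢ x → v ≢ y → adj G v x ≡ adj G v y

twin? : (G : Graph n) → ∀ x y → Dec (Twin G x y)
twin? G x y = all? λ v → ¬? (v ≟ x) →-dec (¬? (v ≟ y) →-dec (adj G v x ≟ᵇ adj G v y))

twin-refl : (G : Graph n) → ∀ x → Twin G x x
twin-refl G x v _ _ = refl

twin-sym : (G : Graph n) → ∀ {x y} → Twin G x y → Twin G y x
twin-sym G t v v≢y v≢x = ≡-sym (t v v≢x v≢y)

twin-trans : (G : Graph n) → ∀ {x y z} → Twin G x y → Twin G y z → Twin G x z
twin-trans G {x} {y} {z} t u v v≢x v≢z with v ≟ y
... | no v≢y = trans (t v v≢x v≢y) (u v v≢y v≢z)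
... | yes refl with x ≟ z
...   | yes refl = refl
-- The middle vertex y is the only critical one: its adjacency to x passes to the pair x, z because
-- y and z look alike from x, and then to the pair z, y because x and y look alike from z.
...   | no x≢z   = begin
  adj G y x ≡⟨ sym G y x ⟩
  adj G x y ≡⟨ u x (≢-sym v≢x) x≢z ⟩
  adj G x z ≡⟨ sym G x z ⟩
  adj G z x ≡⟨ t z (≢-sym x≢z) (≢-sym v≢z) ⟩
  adj G z y ≡⟨ sym G z y ⟩
  adj G y z ∎
  where open ≡-Reasoning

cls : Graph n → Fin n → Subset n
cls G v = ⟪ (λ u → twin? G u v) ⟫

∈cls⁺ : (G : Graph n) → ∀ {u v} → Twin G u v → u ∈ cls G v
∈cls⁺ G {v = v} = ∈⟪⟫⁺ (λ u → twin? G u v)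

∈cls⁻ : (G : Graph n) → ∀ {u v} → u ∈ cls G v → Twin G u v
∈cls⁻ G {v = v} = ∈⟪⟫⁻ (λ u → twin? G u v)

x∈cls : (G : Graph n) → ∀ x → x ∈ cls G x
x∈cls G x = ∈cls⁺ G (twin-refl G x)

cls-cong : (G : Graph n) → ∀ {u v} → Twin G u v → cls G u ≡ cls G v
cls-cong G t = ⊆-antisym
  (λ w∈ → ∈cls⁺ G (twin-trans G (∈cls⁻ G w∈) t))
  (λ w∈ → ∈cls⁺ G (twin-trans G (∈cls⁻ G w∈) (twin-sym G t)))

cls-module : (G : Graph n) → ∀ v → IsModule G (cls G v)
cls-module G v w w∉ x y x∈ y∈ =
  twin-trans G (∈cls⁻ G x∈) (twin-sym G (∈cls⁻ G y∈)) w
    (λ { refl → w∉ x∈ }) (λ { refl → w∉ y∈ })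

-- From v all its twins look alike, so one nonadjacent twin decides for every pair containing v. A
-- pair x, y reduces to x, v because y and v look alike from x.
cls-clique⊎stable : (G : Graph n) → ∀ v → IsClique G (cls G v) ⊎ IsStable G (cls G v)
cls-clique⊎stable G v with any? (λ y → twin? G y v ×-dec ¬? (y ≟ v) ×-dec (adj G v y ≟ᵇ false))
... | no ¬∃ = inj₁ clique
  where
  centre : ∀ y → Twin G y v → y ≢ v → adj G v y ≡ true
  centre y t y≢v = ¬false⇒true λ e → ¬∃ (y , t , y≢v , e)
  clique : IsClique G (cls G v)
  clique x y x∈ y∈ x≢y with x ≟ v | y ≟ v
  ... | yes refl | _        = centre y (∈cls⁻ G y∈) (≢-sym x≢y)
  ... | no x≢v   | yes refl = trans (sym G x v) (centre x (∈cls⁻ G x∈) x≢v)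
  ... | no x≢v   | no y≢v   = trans (∈cls⁻ G y∈ x x≢y x≢v) (trans (sym G x v) (centre x (∈cls⁻ G x∈) x≢v))
... | yes (y₀ , t₀ , y₀≢v , e₀) = inj₂ stable
  where
  centre : ∀ y → Twin G y v → adj G v y ≡ false
  centre y t with y ≟ v
  ... | yes refl = irrefl G v
  ... | no y≢v   = trans (twin-trans G t (twin-sym G t₀) v (≢-sym y≢v) (≢-sym y₀≢v)) e₀
  stable : IsStable G (cls G v)
  stable x y x∈ y∈ with x ≟ y | x ≟ v | y ≟ v
  ... | yes refl | _        | _        = irrefl G x
  ... | no _     | yes refl | _        = centre y (∈cls⁻ G y∈)
  ... | no _     | no _     | yes refl = trans (sym G x v) (centre x (∈cls⁻ G x∈))
  ... | no x≢y   | no x≢v   | no _     = trans (∈cls⁻ G y∈ x x≢y x≢v) (trans (sym G x v) (centre x (∈cls⁻ G x∈)))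

stable-twin : (G : Graph n) (M : Subset n) → IsModule G M → IsStable G M → ∀ {x y} → x ∈ M → y ∈ M → Twin G x y
stable-twin G M mM sM {x} {y} x∈ y∈ v _ _ with v ∈? M
... | yes v∈ = trans (sM v x v∈ x∈) (≡-sym (sM v y v∈ y∈))
... | no v∉  = mM v v∉ x y x∈ y∈

-- Minimal modules without twins

-- A witness against minimality of `B` among the modules with at least two vertices.
SplitModule : Graph n → Subset n → Set
SplitModule G B = ∃ λ A → IsModule G A × Two A × A ⊆ B × ∃ λ z → z ∈ B × z ∉ A

splitModule? : (G : Graph n) (B : Subset n) → Dec (SplitModule G B)
splitModule? G B = anySubset? λ A → module? G A ×-dec two? A ×-dec (A ⊆? B) ×-dec
  any? λ z → (z ∈? B) ×-dec ¬? (z ∈? A)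

TwinFree : Graph n → Subset n → Set
TwinFree G B = ∀ x y → x ∈ B → y ∈ B → Twin G x y → x ≡ y

twinFree? : (G : Graph n) (B : Subset n) → Dec (TwinFree G B)
twinFree? G B = all? λ x → all? λ y → (x ∈? B) →-dec ((y ∈? B) →-dec (twin? G x y →-dec (x ≟ y)))

Prim : Graph n → Subset n → Set
Prim G B = IsModule G B × Two B × ¬ SplitModule G B × TwinFree G B

prim? : (G : Graph n) (B : Subset n) → Dec (Prim G B)
prim? G B = module? G B ×-dec two? B ×-dec ¬? (splitModule? G B) ×-dec twinFree? G B

-- Two members of `B` are not twins, and a vertex that separates them cannot lie outside the module
-- `B`, so it is a third member.
prim-others : (G : Graph n) (B : Subset n) → Prim G B → ∀ {x} → x ∈ B →
              ∃₂ λ y z → y ∈ B × z ∈ B × y ≢ x × z ≢ x × y ≢ z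
prim-others {n} G B (mB , two , _ , free) {x} x∈ with Two⇒other B two x
... | y , y∈ , y≢x with ¬∀⟶∃¬ n (λ v → v ≢ x → v ≢ y → adj G v x ≡ adj G v y)
                          (λ v → ¬? (v ≟ x) →-dec (¬? (v ≟ y) →-dec (adj G v x ≟ᵇ adj G v y)))
                          (λ t → y≢x (≡-sym (free x y x∈ y∈ t)))
...   | z , ¬t = y , z , y∈ , z∈ , y≢x
      , (λ { refl → ¬t λ z≢z _ → contradiction refl z≢z })
      , (λ { refl → ¬t λ _ z≢z → contradiction refl z≢z })
  where
  z∈ : z ∈ B
  z∈ = decidable-stable (z ∈? B) λ z∉ → ¬t λ _ _ → mB z z∉ x y x∈ y∈

-- Otherwise `B` without x would again be a module, as neither x nor a vertex outside `B` separates
-- it. It has two vertices by `prim-others`, against minimality.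
prim-split : (G : Graph n) (B : Subset n) → Prim G B → ∀ {x} → x ∈ B →
             ¬ (∀ a b → a ∈ B → b ∈ B → a ≢ x → b ≢ x → adj G x a ≡ adj G x b)
prim-split {n} G B pB@(mB , _ , min , _) {x} x∈ h with prim-others G B pB x∈
... | y , z , y∈ , z∈ , y≢x , z≢x , y≢z = min (⟪ B∖x? ⟫ , mod
      , (y , z , ∈⟪⟫⁺ B∖x? (y∈ , y≢x) , ∈⟪⟫⁺ B∖x? (z∈ , z≢x) , y≢z)
      , (λ a∈ → proj₁ (∈⟪⟫⁻ B∖x? a∈))
      , x , x∈ , λ x∈' → proj₂ (∈⟪⟫⁻ B∖x? x∈') refl)
  where
  B∖x? : Decidable (λ a → a ∈ B × a ≢ x)
  B∖x? a = (a ∈? B) ×-dec ¬? (a ≟ x)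
  mod : IsModule G ⟪ B∖x? ⟫
  mod v v∉ a b a∈ b∈ with ∈⟪⟫⁻ B∖x? a∈ | ∈⟪⟫⁻ B∖x? b∈ | v ≟ x
  ... | aB , a≢x | bB , b≢x | yes refl = h a b aB bB a≢x b≢x
  ... | aB , a≢x | bB , b≢x | no v≢x   = mB v (λ v∈ → v∉ (∈⟪⟫⁺ B∖x? (v∈ , v≢x))) a b aB bB

-- A twin y outside `B` sees `B` uniformly, and x sees the rest of `B` as y does, which `prim-split`
-- forbids.
prim-twin : (G : Graph n) (B : Subset n) → Prim G B → ∀ {x y} → x ∈ B → Twin G x y → x ≡ y
prim-twin G B pB@(mB , _ , _ , free) {x} {y} x∈ t with y ∈? B
... | yes y∈ = free x y x∈ y∈ t
... | no y∉  = ⊥-elim (prim-split G B pB x∈ λ a b a∈ b∈ a≢x b≢x → begin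
  adj G x a ≡⟨ sym G x a ⟩
  adj G a x ≡⟨ t a a≢x (λ { refl → y∉ a∈ }) ⟩
  adj G a y ≡⟨ sym G a y ⟩
  adj G y a ≡⟨ mB y y∉ a b a∈ b∈ ⟩
  adj G y b ≡⟨ sym G y b ⟩
  adj G b y ≡⟨ t b b≢x (λ { refl → y∉ b∈ }) ⟨
  adj G b x ≡⟨ sym G b x ⟩
  adj G x b ∎)
  where open ≡-Reasoning

-- A second common vertex would make the intersection a smaller module. If x is the only one, take
-- another y in `B'`: it sees `B` uniformly, and the rest of `B` does not separate x from y, so x
-- sees that rest uniformly, against `prim-split`.
prim-⊆ : (G : Graph n) (B B' : Subset n) → Prim G B → Prim G B' → ∀ {x} → x ∈ B → x ∈ B' → B ⊆ B'
prim-⊆ G B B' pB@(mB , _ , min , _) (mB' , two' , _) {x} x∈ x∈' {z} z∈ =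
  decidable-stable (z ∈? B') collide
  where
  open ≡-Reasoning
  collide : z ∉ B' → ⊥
  collide z∉' with any? (λ b → (b ∈? B) ×-dec (b ∈? B') ×-dec ¬? (b ≟ x))
  ... | yes (b , b∈ , b∈' , b≢x) = min (B ∩ B' , module-∩ G B B' mB mB'
        , (b , x , x∈p∩q⁺ (b∈ , b∈') , x∈p∩q⁺ (x∈ , x∈') , b≢x)
        , (λ a∈ → proj₁ (x∈p∩q⁻ B B' a∈)) , z , z∈ , λ z∈∩ → z∉' (proj₂ (x∈p∩q⁻ B B' z∈∩)))
  ... | no ¬∃ with Two⇒other B' two' x
  ...   | y , y∈' , y≢x = prim-split G B pB x∈ λ a b a∈ b∈ a≢x b≢x → begin
    adj G x a ≡⟨ sym G x a ⟩
    adj G a x ≡⟨ mB' a (λ a∈' → ¬∃ (a , a∈ , a∈' , a≢x)) x y x∈' y∈' ⟩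
    adj G a y ≡⟨ sym G a y ⟩
    adj G y a ≡⟨ mB y (λ y∈ → ¬∃ (y , y∈ , y∈' , y≢x)) a b a∈ b∈ ⟩
    adj G y b ≡⟨ sym G y b ⟩
    adj G b y ≡⟨ mB' b (λ b∈' → ¬∃ (b , b∈ , b∈' , b≢x)) x y x∈' y∈' ⟨
    adj G b x ≡⟨ sym G b x ⟩
    adj G x b ∎

-- Pass to properly smaller modules with at least two vertices until none is left; the last one
-- contains twins or is twin-free.
twins⊎prim : (G : Graph n) (M : Subset n) → IsModule G M → Two M →
             (∃₂ λ x y → x ∈ M × y ∈ M × x ≢ y × Twin G x y) ⊎ (∃ λ B → B ⊆ M × Prim G B)
twins⊎prim G M = go M (<-wellFounded ∣ M ∣)
  where
  go : ∀ M → Acc _<_ ∣ M ∣ → IsModule G M → Two M →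
       (∃₂ λ x y → x ∈ M × y ∈ M × x ≢ y × Twin G x y) ⊎ (∃ λ B → B ⊆ M × Prim G B)
  go M (acc rec) mM two with splitModule? G M
  ... | yes (A , mA , twoA , A⊆M , z , z∈ , z∉) with go A (rec (p⊂q⇒∣p∣<∣q∣ (A⊆M , z , z∈ , z∉))) mA twoA
  ...   | inj₁ (x , y , x∈ , y∈ , x≢y , t) = inj₁ (x , y , A⊆M x∈ , A⊆M y∈ , x≢y , t)
  ...   | inj₂ (B , B⊆A , pB) = inj₂ (B , (λ b∈ → A⊆M (B⊆A b∈)) , pB)
  go M (acc rec) mM two | no ¬split
    with any? (λ x → any? λ y → (x ∈? M) ×-dec (y ∈? M) ×-dec ¬? (x ≟ y) ×-dec twin? G x y)
  ...   | yes t = inj₁ t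
  ...   | no ¬t = inj₂ (M , (λ x∈ → x∈) , mM , two , ¬split
                    , λ x y x∈ y∈ t → decidable-stable (x ≟ y) λ x≢y → ¬t (x , y , x∈ , y∈ , x≢y , t))

-- Extensions by a stable set

glue : Graph n → (Fin n → Fin p → Bool) → Graph (n + p)
glue {n} {p} G N = record
  { adj    = λ i j → adj⊎ (splitAt n i) (splitAt n j)
  ; sym    = λ i j → sym⊎ (splitAt n i) (splitAt n j)
  ; irrefl = λ i → irrefl⊎ (splitAt n i)
  }
  where
  adj⊎ : Fin n ⊎ Fin p → Fin n ⊎ Fin p → Bool
  adj⊎ (inj₁ x) (inj₁ y) = adj G x y
  adj⊎ (inj₁ x) (inj₂ q) = N x q
  adj⊎ (inj₂ q) (inj₁ x) = N x q
  adj⊎ (inj₂ _) (inj₂ _) = false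
  sym⊎ : ∀ i j → adj⊎ i j ≡ adj⊎ j i
  sym⊎ (inj₁ x) (inj₁ y) = sym G x y
  sym⊎ (inj₁ _) (inj₂ _) = refl
  sym⊎ (inj₂ _) (inj₁ _) = refl
  sym⊎ (inj₂ _) (inj₂ _) = refl
  irrefl⊎ : ∀ i → adj⊎ i i ≡ false
  irrefl⊎ (inj₁ x) = irrefl G x
  irrefl⊎ (inj₂ _) = refl

glue-old : (G : Graph n) (N : Fin n → Fin p → Bool) → IsExtension p G (glue G N)
glue-old {n} {p} G N x y rewrite splitAt-↑ˡ n x p | splitAt-↑ˡ n y p = refl

glue-old-new : (G : Graph n) (N : Fin n → Fin p → Bool) → ∀ x q → adj (glue G N) (x ↑ˡ p) (n ↑ʳ q) ≡ N x q
glue-old-new {n} {p} G N x q rewrite splitAt-↑ˡ n x p | splitAt-↑ʳ n p q = refl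

glue-new-old : (G : Graph n) (N : Fin n → Fin p → Bool) → ∀ x q → adj (glue G N) (n ↑ʳ q) (x ↑ˡ p) ≡ N x q
glue-new-old {n} {p} G N x q = trans (sym (glue G N) (n ↑ʳ q) (x ↑ˡ p)) (glue-old-new G N x q)

old⊎new : (i : Fin (n + p)) → (∃ λ x → i ≡ x ↑ˡ p) ⊎ (∃ λ q → i ≡ n ↑ʳ q)
old⊎new {n} {p} i with splitAt n i | join-splitAt n p i
... | inj₁ x | e = inj₁ (x , ≡-sym e)
... | inj₂ q | e = inj₂ (q , ≡-sym e)

old≢new : (x : Fin n) (q : Fin p) → x ↑ˡ p ≢ n ↑ʳ q
old≢new {n} {p} x q e with trans (≡-sym (splitAt-↑ˡ n x p)) (trans (cong (splitAt n) e) (splitAt-↑ʳ n p q))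
... | ()

-- Labels are injective on twin classes, and 0 occurs only in full classes and once in each minimal twin-free module.
module Labels {n : ℕ} (G : Graph n) (k : ℕ) (1≤k : 1 ≤ k) (cls≤ : ∀ v → ∣ cls G v ∣ ≤ 2 ^ k) where

  Leader : Fin n → Set
  Leader v = ∃ λ B → Prim G B × v ∈ B × rank B v ≡ 0

  leader? : Decidable Leader
  leader? v = anySubset? λ B → prim? G B ×-dec (v ∈? B) ×-dec (rank B v ≟ⁿ 0)

  -- A leader takes 0. In a class below full size the ranks move up by one to keep 0 free; a full
  -- class needs all numbers below 2 ^ k, so its ranks stay.
  pick : {P Q : Set} → Dec P → Dec Q → ℕ → ℕ
  pick (yes _) _       r = 0
  pick (no _)  (yes _) r = suc r
  pick (no _)  (no _)  r = r

  label : Fin n → ℕ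
  label v = pick (leader? v) (∣ cls G v ∣ <? 2 ^ k) (rank (cls G v) v)

  data LabelView (v : Fin n) : Set where
    leader : Leader v → label v ≡ 0 → LabelView v
    small  : ¬ Leader v → ∣ cls G v ∣ < 2 ^ k → label v ≡ suc (rank (cls G v) v) → LabelView v
    full   : ¬ Leader v → ∣ cls G v ∣ ≡ 2 ^ k → label v ≡ rank (cls G v) v → LabelView v

  labelView : ∀ v → LabelView v
  labelView v = view (leader? v) (∣ cls G v ∣ <? 2 ^ k) refl
    where
    view : (d : Dec (Leader v)) (e : Dec (∣ cls G v ∣ < 2 ^ k)) → label v ≡ pick d e (rank (cls G v) v) → LabelView v
    view (yes l) _        eq = leader l eq
    view (no ¬l) (yes lt) eq = small ¬l lt eq
    view (no ¬l) (no ≮)   eq = full ¬l (≤-antisym (cls≤ v) (≮⇒≥ ≮)) eq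

  rank-cls< : ∀ v → rank (cls G v) v < ∣ cls G v ∣
  rank-cls< v = rank< (cls G v) (x∈cls G v)

  label< : ∀ v → label v < 2 ^ k
  label< v with labelView v
  ... | leader _ e   rewrite e = ≤-trans (s≤s z≤n) (2≤2^ 1≤k)
  ... | small _ lt e rewrite e = ≤-trans (s≤s (rank-cls< v)) lt
  ... | full _ fl e  rewrite e = <-≤-trans (rank-cls< v) (≤-reflexive fl)

  leader-twin : ∀ {u v} → Leader u → Twin G u v → u ≡ v
  leader-twin (B , pB , u∈ , _) = prim-twin G B pB u∈

  -- A leader has no other twin. Twins that are not leaders share their class, hence the same shift
  -- of the same ranking.
  label-twin : ∀ {u v} → Twin G u v → label u ≡ label v → u ≡ v
  label-twin {u} {v} t e with labelView u | labelView v
  ... | leader l _ | _ = leader-twin l t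
  ... | _ | leader l _ = ≡-sym (leader-twin l (twin-sym G t))
  ... | small _ lt _ | full _ fl _ = contradiction (trans (cong ∣_∣ (cls-cong G t)) fl) λ e' → <-irrefl e' lt
  ... | full _ fl _ | small _ lt _ = contradiction (trans (≡-sym (cong ∣_∣ (cls-cong G t))) fl) λ e' → <-irrefl e' lt
  ... | small _ _ eu | small _ _ ev = rank-injective (cls G v) (∈cls⁺ G t) (x∈cls G v)
        (trans (cong (λ S → rank S u) (≡-sym (cls-cong G t))) (suc-injective (trans (≡-sym eu) (trans e ev))))
  ... | full _ _ eu | full _ _ ev = rank-injective (cls G v) (∈cls⁺ G t) (x∈cls G v)
        (trans (cong (λ S → rank S u) (≡-sym (cls-cong G t))) (trans (≡-sym eu) (trans e ev)))

  full-cls-other : ∀ {v} → ∣ cls G v ∣ ≡ 2 ^ k → ∀ x → ∃ λ y → Twin G y v × y ≢ x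
  full-cls-other {v} fl x with Two⇒other (cls G v) (2≤⇒Two _ (≤-trans (2≤2^ 1≤k) (≤-reflexive (≡-sym fl)))) x
  ... | y , y∈ , y≢x = y , ∈cls⁻ G y∈ , y≢x

  full-twin : ∀ {v} → ∣ cls G v ∣ ≡ 2 ^ k → ¬ (∀ y → Twin G y v → y ≡ v)
  full-twin {v} fl h with full-cls-other fl v
  ... | y , t , y≢v = y≢v (h y t)

  full-label : ∀ {v} → ∣ cls G v ∣ ≡ 2 ^ k → label v ≡ rank (cls G v) v
  full-label {v} fl with labelView v
  ... | leader l _   = contradiction (λ y t → ≡-sym (leader-twin l (twin-sym G t))) (full-twin fl)
  ... | small _ lt _ = contradiction lt (<-irrefl fl)
  ... | full _ _ e   = e

  leader-label : ∀ {v} → Leader v → label v ≡ 0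
  leader-label {v} l with labelView v
  ... | leader _ e   = e
  ... | small ¬l _ _ = contradiction l ¬l
  ... | full ¬l _ _  = contradiction l ¬l

  -- A member of `B` has no other twin, so its class is not full and label 0 makes it a leader, by
  -- `prim-⊆` of `B` itself. Only one member has rank 0.
  prim-label : (B : Subset n) → Prim G B → ∀ {x y} → x ∈ B → y ∈ B → label x ≡ 0 → label y ≡ 0 → x ≡ y
  prim-label B pB x∈ y∈ ex ey = rank-injective B x∈ y∈ (trans (first x∈ ex) (≡-sym (first y∈ ey)))
    where
    first : ∀ {x} → x ∈ B → label x ≡ 0 → rank B x ≡ 0
    first {x} x∈ e with labelView x
    ... | leader (B' , pB' , x∈' , r) _ =
          subst (λ S → rank S x ≡ 0) (⊆-antisym (prim-⊆ G B' B pB' pB x∈' x∈) (prim-⊆ G B B' pB pB' x∈ x∈')) r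
    ... | small _ _ e' = contradiction (trans (≡-sym e) e') λ ()
    ... | full _ fl _  = contradiction (λ y t → ≡-sym (prim-twin G B pB x∈ (twin-sym G t))) (full-twin fl)

-- A prime k-extension

module Extend {n : ℕ} (G : Graph n) (k : ℕ) (1≤k : 1 ≤ k) (cls≤ : ∀ v → ∣ cls G v ∣ ≤ 2 ^ k)
  (c₀ : Fin n) (c₀-full : ∣ cls G c₀ ∣ ≡ 2 ^ k) (c₀-stable : ∀ c → Twin G c c₀ → adj G c₀ c ≡ false)
  (no-isolated : ∀ v → ∣ cls G v ∣ ≡ 2 ^ k → ¬ (∀ y → adj G v y ≡ false))
  (no-universal : ∀ v → ∣ cls G v ∣ ≡ 2 ^ k → ¬ (∀ y → y ≢ v → adj G v y ≡ true)) where

  open Labels G k 1≤k cls≤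

  -- Because of the twist by adj c₀, only a vertex labelled 0 can see the class of c₀ and all new vertices alike.
  N : Fin n → Fin k → Bool
  N x q = adj G c₀ x xor decode (label x) q

  H : Graph (n + k)
  H = glue G N

  xor-cancelˡ : ∀ a {b c} → a xor b ≡ a xor c → b ≡ c
  xor-cancelˡ false e = e
  xor-cancelˡ true  e = not-injective e

  xor-falseʳ : ∀ a {b} → a xor b ≡ a → b ≡ false
  xor-falseʳ false e = e
  xor-falseʳ true  {false} e = refl

  class-stable : ∀ {c d} → Twin G c c₀ → Twin G d c₀ → adj G c d ≡ false
  class-stable {c} {d} tc td with c ≟ d | c ≟ c₀
  ... | yes refl | _        = irrefl G c
  ... | no _     | yes refl = c₀-stable d td
  ... | no c≢d   | no c≢c₀  = trans (td c c≢d c≢c₀) (trans (sym G c c₀) (c₀-stable c tc))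

  -- The labels on this full class are its ranks and take all values below 2 ^ k. The twist vanishes
  -- there because the class is stable.
  class-label : (f : Fin k → Bool) → ∃ λ c → Twin G c c₀ × (∀ q → N c q ≡ f q)
  class-label f with rank-surjective (cls G c₀) (<-≤-trans (code< f) (≤-reflexive (≡-sym c₀-full)))
  ... | c , c∈ , r = c , t , λ q → trans
          (cong₂ _xor_ (c₀-stable c t) (cong (λ i → decode i q) label≡)) (decode-code f q)
    where
    t : Twin G c c₀
    t = ∈cls⁻ G c∈
    label≡ : label c ≡ code f
    label≡ = trans (full-label (trans (cong ∣_∣ (cls-cong G t)) c₀-full))
               (trans (cong (λ S → rank S c) (cls-cong G t)) r)

  centre-twin : ∀ {x y} → Twin G x y → adj G c₀ x ≡ adj G c₀ y
  centre-twin {x} {y} t with x ≟ c₀ | y ≟ c₀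
  ... | yes refl | _        = trans (irrefl G x) (≡-sym (c₀-stable y (twin-sym G t)))
  ... | no _     | yes refl = trans (c₀-stable x t) (≡-sym (irrefl G y))
  ... | no x≢c₀  | no y≢c₀  = t c₀ (≢-sym x≢c₀) (≢-sym y≢c₀)

  label-separates : ∀ {x y} → adj G c₀ x ≡ adj G c₀ y → label x ≢ label y → ∃ λ q → N x q ≢ N y q
  label-separates {x} {y} e l≢ = ¬∀⟶∃¬ k (λ q → N x q ≡ N y q) (λ q → N x q ≟ᵇ N y q) λ h →
    l≢ (decode-injective k (label< x) (label< y) λ q →
      xor-cancelˡ (adj G c₀ x) (trans (h q) (cong (_xor decode (label y) q) (≡-sym e))))

  -- Twins have the same twist and distinct labels. In a minimal twin-free module the leader alone
  -- has label 0, and the twist is constant because `c₀`, having twins, lies outside.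
  module-separated : (M : Subset n) → IsModule G M → Two M → ∃₂ λ x y → x ∈ M × y ∈ M × ∃ λ q → N x q ≢ N y q
  module-separated M mM two with twins⊎prim G M mM two
  ... | inj₁ (x , y , x∈ , y∈ , x≢y , t) =
        x , y , x∈ , y∈ , label-separates (centre-twin t) (λ e → x≢y (label-twin t e))
  ... | inj₂ (B , B⊆M , pB@(mB , twoB , _)) with rank-surjective B (∣B∣>0 twoB)
    where
    ∣B∣>0 : Two B → 0 < ∣ B ∣
    ∣B∣>0 (_ , _ , a∈ , _) = ≤-<-trans z≤n (rank< B a∈)
  ...   | x , x∈ , r with Two⇒other B twoB x
  ...     | y , y∈ , y≢x = x , y , B⊆M x∈ , B⊆M y∈ , label-separates (mB c₀ c₀∉ x y x∈ y∈)
              (λ e → y≢x (prim-label B pB y∈ x∈ (trans (≡-sym e) lx) lx))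
    where
    lx : label x ≡ 0
    lx = leader-label (B , pB , x∈ , r)
    c₀∉ : c₀ ∉ B
    c₀∉ c₀∈ = full-twin c₀-full λ c t → ≡-sym (prim-twin G B pB c₀∈ (twin-sym G t))

  module InModule (M : Subset (n + k)) (mM : IsModule H M) (two : Two M) where

    restricted? : Decidable (λ x → x ↑ˡ k ∈ M)
    restricted? x = x ↑ˡ k ∈? M

    restriction-module : IsModule G ⟪ restricted? ⟫
    restriction-module v v∉ x y x∈ y∈ = trans (≡-sym (glue-old G N v x)) (trans
      (mM (v ↑ˡ k) (λ v∈ → v∉ (∈⟪⟫⁺ restricted? v∈)) (x ↑ˡ k) (y ↑ˡ k) (∈⟪⟫⁻ restricted? x∈) (∈⟪⟫⁻ restricted? y∈))
      (glue-old G N v y))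

    -- Without new vertices, `M` would be a module of `G` that no new vertex separates, contrary to
    -- `module-separated`.
    meets-new : ∃ λ q → n ↑ʳ q ∈ M
    meets-new = decidable-stable (any? λ q → n ↑ʳ q ∈? M) λ ¬∃ → separated ¬∃ two
      where
      old : ¬ (∃ λ q → n ↑ʳ q ∈ M) → ∀ i → i ∈ M → ∃ λ x → i ≡ x ↑ˡ k
      old ¬∃ i i∈ with old⊎new {n} i
      ... | inj₁ x          = x
      ... | inj₂ (q , refl) = contradiction (q , i∈) ¬∃
      separated : ¬ (∃ λ q → n ↑ʳ q ∈ M) → Two M → ⊥
      separated ¬∃ (i , j , i∈ , j∈ , i≢j) with old ¬∃ i i∈ | old ¬∃ j j∈
      ... | x , refl | y , refl with module-separated ⟪ restricted? ⟫ restriction-module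
              (x , y , ∈⟪⟫⁺ restricted? i∈ , ∈⟪⟫⁺ restricted? j∈ , λ { refl → i≢j refl })
      ...   | u , v , u∈ , v∈ , q , N≢ = N≢ (trans (≡-sym (glue-new-old G N u q)) (trans
                (mM (n ↑ʳ q) (λ q∈ → ¬∃ (q , q∈)) (u ↑ˡ k) (v ↑ˡ k) (∈⟪⟫⁻ restricted? u∈) (∈⟪⟫⁻ restricted? v∈))
                (glue-new-old G N v q)))

    q₀ : Fin k
    q₀ = proj₁ meets-new

    q₀∈ : n ↑ʳ q₀ ∈ M
    q₀∈ = proj₂ meets-new

    -- Three members of the class of `c₀` serve as probes: among the new vertices they see only
    -- `q₀`, all of them, and none.
    one : ∃ λ c → Twin G c c₀ × (∀ q → N c q ≡ does (q ≟ q₀))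
    one = class-label (λ q → does (q ≟ q₀))

    all : ∃ λ c → Twin G c c₀ × (∀ q → N c q ≡ true)
    all = class-label (const true)

    none : ∃ λ c → Twin G c c₀ × (∀ q → N c q ≡ false)
    none = class-label (const false)

    c₁ c∗ c∅ : Fin n
    c₁ = proj₁ one
    c∗ = proj₁ all
    c∅ = proj₁ none

    -- Otherwise `M` contains a second new vertex, and `c₁`, lying outside, tells it from `q₀`.
    meets-old : ∃ λ x → x ↑ˡ k ∈ M
    meets-old = decidable-stable (any? λ x → x ↑ˡ k ∈? M) λ ¬∃ → separated ¬∃ (Two⇒other M two (n ↑ʳ q₀))
      where
      separated : ¬ (∃ λ x → x ↑ˡ k ∈ M) → ¬ (∃ λ i → i ∈ M × i ≢ n ↑ʳ q₀)
      separated ¬∃ (i , i∈ , i≢) with old⊎new {n} i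
      ... | inj₁ (x , refl) = ¬∃ (x , i∈)
      ... | inj₂ (q , refl) = contradiction (begin
          true                       ≡⟨ dec-true (q₀ ≟ q₀) refl ⟨
          does (q₀ ≟ q₀)             ≡⟨ proj₂ (proj₂ one) q₀ ⟨
          N c₁ q₀                    ≡⟨ glue-old-new G N c₁ q₀ ⟨
          adj H (c₁ ↑ˡ k) (n ↑ʳ q₀)  ≡⟨ mM (c₁ ↑ˡ k) (λ c∈ → ¬∃ (c₁ , c∈)) (n ↑ʳ q₀) (n ↑ʳ q) q₀∈ i∈ ⟩
          adj H (c₁ ↑ˡ k) (n ↑ʳ q)   ≡⟨ glue-old-new G N c₁ q ⟩
          N c₁ q                     ≡⟨ proj₂ (proj₂ one) q ⟩
          does (q ≟ q₀)              ≡⟨ dec-false (q ≟ q₀) (λ { refl → i≢ refl }) ⟩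
          false                      ∎) λ ()
        where open ≡-Reasoning

    N-old : ∀ {x y} → x ↑ˡ k ∉ M → y ↑ˡ k ∈ M → ∀ {q} → n ↑ʳ q ∈ M → N x q ≡ adj G x y
    N-old {x} {y} x∉ y∈ {q} q∈ = trans (≡-sym (glue-old-new G N x q)) (trans
      (mM (x ↑ˡ k) x∉ (n ↑ʳ q) (y ↑ˡ k) q∈ y∈) (glue-old G N x y))

    -- If the whole class were outside, the twins `c∗` and `c∅` would see an old vertex of `M`
    -- alike, while only `c∗` sees `q₀`.
    meets-class : ∃ λ c → Twin G c c₀ × c ↑ˡ k ∈ M
    meets-class = decidable-stable (any? λ c → twin? G c c₀ ×-dec (c ↑ˡ k ∈? M)) λ ¬∃ → separated ¬∃ meets-old
      where
      separated : ¬ (∃ λ c → Twin G c c₀ × c ↑ˡ k ∈ M) → ¬ (∃ λ x → x ↑ˡ k ∈ M)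
      separated ¬∃ (x , x∈) = contradiction (begin
          true        ≡⟨ proj₂ (proj₂ all) q₀ ⟨
          N c∗ q₀     ≡⟨ N-old (out t∗) x∈ q₀∈ ⟩
          adj G c∗ x  ≡⟨ sym G c∗ x ⟩
          adj G x c∗  ≡⟨ twin-trans G t∗ (twin-sym G t∅) x (apart t∗) (apart t∅) ⟩
          adj G x c∅  ≡⟨ sym G x c∅ ⟩
          adj G c∅ x  ≡⟨ N-old (out t∅) x∈ q₀∈ ⟨
          N c∅ q₀     ≡⟨ proj₂ (proj₂ none) q₀ ⟩
          false       ∎) λ ()
        where
        open ≡-Reasoning
        t∗ : Twin G c∗ c₀
        t∗ = proj₁ (proj₂ all)
        t∅ : Twin G c∅ c₀
        t∅ = proj₁ (proj₂ none)
        out : ∀ {c} → Twin G c c₀ → c ↑ˡ k ∉ M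
        out {c} t c∈ = ¬∃ (c , t , c∈)
        apart : ∀ {c} → Twin G c c₀ → x ≢ c
        apart t refl = out t x∈

    -- Outside `M`, c would have to see a class member in `M` as it sees `q₀`, but the class is
    -- stable.
    class-in : ∀ {c} → Twin G c c₀ → N c q₀ ≡ true → c ↑ˡ k ∈ M
    class-in {c} t Nc = decidable-stable (c ↑ˡ k ∈? M) λ c∉ → contradiction
      (trans (≡-sym Nc) (trans (N-old c∉ (proj₂ (proj₂ meets-class)) q₀∈)
        (class-stable t (proj₁ (proj₂ meets-class))))) λ ()

    c∗∈ : c∗ ↑ˡ k ∈ M
    c∗∈ = class-in (proj₁ (proj₂ all)) (proj₂ (proj₂ all) q₀)

    c₁∈ : c₁ ↑ˡ k ∈ M
    c₁∈ = class-in (proj₁ (proj₂ one)) (trans (proj₂ (proj₂ one) q₀) (dec-true (q₀ ≟ q₀) refl))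

    -- Every new vertex other than `q₀` separates `c∗` from `c₁`, and both lie in `M`.
    new⊆M : ∀ q → n ↑ʳ q ∈ M
    new⊆M q = decidable-stable (n ↑ʳ q ∈? M) λ q∉ → contradiction (begin
        true                             ≡⟨ proj₂ (proj₂ all) q ⟨
        N c∗ q                           ≡⟨ glue-new-old G N c∗ q ⟨
        adj H (n ↑ʳ q) (c∗ ↑ˡ k)         ≡⟨ mM (n ↑ʳ q) q∉ (c∗ ↑ˡ k) (c₁ ↑ˡ k) c∗∈ c₁∈ ⟩
        adj H (n ↑ʳ q) (c₁ ↑ˡ k)         ≡⟨ glue-new-old G N c₁ q ⟩
        N c₁ q                           ≡⟨ proj₂ (proj₂ one) q ⟩
        does (q ≟ q₀)                    ≡⟨ dec-false (q ≟ q₀) (λ { refl → q∉ q₀∈ }) ⟩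
        false                            ∎) λ ()
      where open ≡-Reasoning

    -- Outside `M`, x sees all new vertices as it sees `c∗`, hence as `c₀` sees x. This value is the
    -- twist, so the untwisted code of x is empty.
    outside-label : ∀ {x} → x ↑ˡ k ∉ M → label x ≡ 0
    outside-label {x} x∉ = decode-zero⁻¹ k (label< x) λ q →
      xor-falseʳ (adj G c₀ x) (trans (N-old x∉ c∗∈ (new⊆M q)) (trans (sym G x c∗) seen))
      where
      t∗ : Twin G c∗ c₀
      t∗ = proj₁ (proj₂ all)
      seen : adj G c∗ x ≡ adj G c₀ x
      seen with x ≟ c₀
      ... | yes refl = trans (class-stable t∗ (twin-refl G c₀)) (≡-sym (irrefl G c₀))
      ... | no x≢c₀  = trans (sym G c∗ x) (trans (t∗ x (λ { refl → x∉ c∗∈ }) x≢c₀) (sym G x c₀))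

    outside-uniform : ∀ {x y z} → x ↑ˡ k ∉ M → y ↑ˡ k ∈ M → z ↑ˡ k ∈ M → adj G x y ≡ adj G x z
    outside-uniform x∉ y∈ z∈ = trans (≡-sym (N-old x∉ y∈ q₀∈)) (N-old x∉ z∈ q₀∈)

    -- Label 0 leaves only full classes and leaders. If x led `B`, the rest of `B` would have
    -- nonzero labels and lie in `M`, so x would see it uniformly, against `prim-split`.
    outside-full : ∀ {x} → x ↑ˡ k ∉ M → ∣ cls G x ∣ ≡ 2 ^ k
    outside-full {x} x∉ with labelView x
    ... | full _ fl _ = fl
    ... | small _ _ e = contradiction (trans (≡-sym (outside-label x∉)) e) λ ()
    ... | leader (B , pB , x∈ , _) lx = ⊥-elim (prim-split G B pB x∈ λ a b a∈ b∈ a≢x b≢x →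
            outside-uniform x∉ (inside a∈ a≢x) (inside b∈ b≢x))
      where
      inside : ∀ {a} → a ∈ B → a ≢ x → a ↑ˡ k ∈ M
      inside {a} a∈ a≢x = decidable-stable (a ↑ˡ k ∈? M) λ a∉ →
        a≢x (prim-label B pB a∈ x∈ (outside-label a∉) lx)

    outside-twin : ∀ {x} → x ↑ˡ k ∉ M → ∃ λ y → Twin G y x × y ↑ˡ k ∈ M
    outside-twin {x} x∉ = inside (full-cls-other (outside-full x∉) x)
      where
      inside : (∃ λ y → Twin G y x × y ≢ x) → ∃ λ y → Twin G y x × y ↑ˡ k ∈ M
      inside (y , t , y≢x) = y , t , decidable-stable (y ↑ˡ k ∈? M) λ y∉ →
        y≢x (label-twin t (trans (outside-label y∉) (≡-sym (outside-label x∉))))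

    -- A vertex x outside sees `M` uniformly, and it sees any other outside vertex as it sees a twin
    -- of that vertex in `M`. Hence x would be isolated or universal in `G`, with a full class.
    old⊆M : ∀ x → x ↑ˡ k ∈ M
    old⊆M x = decidable-stable (x ↑ˡ k ∈? M) λ x∉ → impossible x∉ _ refl
      where
      impossible : x ↑ˡ k ∉ M → ∀ b → adj G x c∗ ≡ b → ⊥
      impossible x∉ b e = conclude b uniform
        where
        uniform : ∀ z → z ≢ x → adj G x z ≡ b
        uniform z z≢x with z ↑ˡ k ∈? M
        ... | yes z∈ = trans (outside-uniform x∉ z∈ c∗∈) e
        ... | no z∉  = via-twin (outside-twin z∉)
          where
          via-twin : (∃ λ y → Twin G y z × y ↑ˡ k ∈ M) → adj G x z ≡ b
          via-twin (y , t , y∈) = trans (≡-sym (t x (λ { refl → x∉ y∈ }) (≢-sym z≢x))) (trans (outside-uniform x∉ y∈ c∗∈) e)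
        conclude : ∀ b → (∀ z → z ≢ x → adj G x z ≡ b) → ⊥
        conclude true  u = no-universal x (outside-full x∉) u
        conclude false u = no-isolated x (outside-full x∉) isolated
          where
          isolated : ∀ z → adj G x z ≡ false
          isolated z with z ≟ x
          ... | yes refl = irrefl G x
          ... | no z≢x   = u z z≢x

    M-full : ∀ i → i ∈ M
    M-full i with old⊎new {n} i
    ... | inj₁ (x , refl) = old⊆M x
    ... | inj₂ (q , refl) = new⊆M q

  -- Since `c₀` is not isolated, it has a neighbour, which lies outside its stable class. With k at
  -- least 1 this yields the four vertices that primality requires.
  2^k<n : 2 ^ k < n
  2^k<n with ¬∀⟶∃¬ n (λ y → adj G c₀ y ≡ false) (λ y → adj G c₀ y ≟ᵇ false) (no-isolated c₀ c₀-full)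
  ... | y , y≁ = subst₂ _<_ c₀-full (∣⊤∣≡n n)
        (p⊂q⇒∣p∣<∣q∣ ((λ _ → ∈⊤) , y , ∈⊤ , λ y∈ → y≁ (c₀-stable y (∈cls⁻ G y∈))))

  prime-extension : HasPrimeExtension G k
  prime-extension = H , glue-old G N
    , prime-intro H (+-mono-≤ (≤-trans (s≤s (2≤2^ 1≤k)) 2^k<n) 1≤k) InModule.M-full

-- Isolated vertices

Isolated : Graph n → Fin n → Set
Isolated G v = ∀ y → adj G v y ≡ false

isolated? : (G : Graph n) → Decidable (Isolated G)
isolated? G v = all? λ y → adj G v y ≟ᵇ false

isolatedSet : Graph n → Subset n
isolatedSet G = ⟪ isolated? G ⟫

∈isolated⁺ : (G : Graph n) → ∀ {v} → Isolated G v → v ∈ isolatedSet G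
∈isolated⁺ G = ∈⟪⟫⁺ (isolated? G)

∈isolated⁻ : (G : Graph n) → ∀ {v} → v ∈ isolatedSet G → Isolated G v
∈isolated⁻ G = ∈⟪⟫⁻ (isolated? G)

sum-indicator : (f : Fin n → Bool) → sum (List.tabulate (λ v → if f v then 1 else 0)) ≡ ∣ tabulate f ∣
sum-indicator {zero}  f = refl
sum-indicator {suc n} f with f zero
... | true  = cong suc (sum-indicator (f ∘ suc))
... | false = sum-indicator (f ∘ suc)

and-tabulate⁺ : (f : Fin n → Bool) → (∀ i → f i ≡ true) → and (List.tabulate f) ≡ true
and-tabulate⁺ {zero}  f h = refl
and-tabulate⁺ {suc n} f h rewrite h zero = and-tabulate⁺ (f ∘ suc) (h ∘ suc)

and-tabulate⁻ : (f : Fin n → Bool) → and (List.tabulate f) ≡ true → ∀ i → f i ≡ true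
and-tabulate⁻ {suc n} f h i with f zero in e
and-tabulate⁻ {suc n} f h zero    | true = e
and-tabulate⁻ {suc n} f h (suc i) | true = and-tabulate⁻ (f ∘ suc) h i

≡does : {P : Set} {b : Bool} (d : Dec P) → (P → b ≡ true) → (b ≡ true → P) → b ≡ does d
≡does (yes x) P⇒b b⇒P = P⇒b x
≡does (no ¬x) P⇒b b⇒P = ¬true⇒false (¬x ∘ b⇒P)

isIsolatedᵇ≡ : (G : Graph n) → ∀ v → isIsolatedᵇ G v ≡ does (isolated? G v)
isIsolatedᵇ≡ {n} G v = ≡does (isolated? G v)
  (λ iso → trans tab (and-tabulate⁺ nonadj (λ y → cong not (iso y))))
  (λ e y → not-injective (and-tabulate⁻ nonadj (trans (≡-sym tab) e) y))
  where
  nonadj : Fin n → Bool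
  nonadj y = not (adj G v y)
  tab : isIsolatedᵇ G v ≡ and (List.tabulate nonadj)
  tab = cong and (map-tabulate (λ y → y) nonadj)

ι≡∣isolatedSet∣ : (G : Graph n) → ι G ≡ ∣ isolatedSet G ∣
ι≡∣isolatedSet∣ {n} G = trans (cong sum (map-tabulate {n = n} (λ v → v) _))
  (trans (sum-indicator (isIsolatedᵇ G)) (cong ∣_∣ (tabulate-cong (isIsolatedᵇ≡ G))))

isolated-cls : (G : Graph n) → ∀ {v} → Isolated G v → cls G v ≡ isolatedSet G
isolated-cls G {v} iso = ⊆-antisym
  (λ {u} u∈ → ∈isolated⁺ G (twin-isolated (∈cls⁻ G u∈)))
  (λ {u} u∈ → ∈cls⁺ G λ w _ _ → trans (sym G w u) (trans (∈isolated⁻ G u∈ w) (≡-sym (trans (sym G w v) (iso w)))))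
  where
  twin-isolated : ∀ {u} → Twin G u v → Isolated G u
  twin-isolated {u} t y with y ≟ u | y ≟ v
  ... | yes refl | _        = irrefl G y
  ... | no _     | yes refl = trans (sym G u y) (iso u)
  ... | no y≢u   | no y≢v   = trans (sym G u y) (trans (t y y≢u y≢v) (trans (sym G y v) (iso y)))

-- Translates the conditions on `ι` into the presence or absence of a full class of isolated
-- vertices.
isolated-ι : (G : Graph n) → ∀ {v} → Isolated G v → ι G ≡ ∣ cls G v ∣
isolated-ι G iso = trans (ι≡∣isolatedSet∣ G) (cong ∣_∣ (≡-sym (isolated-cls G iso)))

-- Complementation

-- An eliminator in place of `with`, which would also abstract the equality test inside the
-- adjacency of `complement`.
≡-cases : {P : Set} (x y : Fin n) → (x ≡ y → P) → (x ≢ y → P) → P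
≡-cases x y f g with x ≟ y
... | yes x≡y = f x≡y
... | no x≢y  = g x≢y

complement-≢ : (G : Graph n) → ∀ {x y} → x ≢ y → adj (complement G) x y ≡ not (adj G x y)
complement-≢ G {x} {y} x≢y with x ≟ y
... | yes x≡y = contradiction x≡y x≢y
... | no _    = ∧-identityʳ _

twin-complement⁺ : (G : Graph n) → ∀ {x y} → Twin G x y → Twin (complement G) x y
twin-complement⁺ G t v v≢x v≢y =
  trans (complement-≢ G v≢x) (trans (cong not (t v v≢x v≢y)) (≡-sym (complement-≢ G v≢y)))

twin-complement⁻ : (G : Graph n) → ∀ {x y} → Twin (complement G) x y → Twin G x y
twin-complement⁻ G t v v≢x v≢y =
  not-injective (trans (≡-sym (complement-≢ G v≢x)) (trans (t v v≢x v≢y) (complement-≢ G v≢y)))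

cls-complement : (G : Graph n) → ∀ v → cls (complement G) v ≡ cls G v
cls-complement G v = ⊆-antisym
  (λ u∈ → ∈cls⁺ G (twin-complement⁻ G (∈cls⁻ (complement G) u∈)))
  (λ u∈ → ∈cls⁺ (complement G) (twin-complement⁺ G (∈cls⁻ G u∈)))

module-complement⁺ : (G : Graph n) (M : Subset n) → IsModule G M → IsModule (complement G) M
module-complement⁺ G M mM v v∉ x y x∈ y∈ =
  trans (complement-≢ G λ { refl → v∉ x∈ }) (trans (cong not (mM v v∉ x y x∈ y∈))
    (≡-sym (complement-≢ G λ { refl → v∉ y∈ })))

module-complement⁻ : (G : Graph n) (M : Subset n) → IsModule (complement G) M → IsModule G M
module-complement⁻ G M mM v v∉ x y x∈ y∈ = not-injective
  (trans (≡-sym (complement-≢ G λ { refl → v∉ x∈ })) (trans (mM v v∉ x y x∈ y∈)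
    (complement-≢ G λ { refl → v∉ y∈ })))

clique-complement : (G : Graph n) (M : Subset n) → IsClique G M → IsStable (complement G) M
clique-complement G M cM x y x∈ y∈ = ≡-cases x y
  (λ { refl → irrefl (complement G) x })
  (λ x≢y → trans (complement-≢ G x≢y) (cong not (cM x y x∈ y∈ x≢y)))

universal-complement : (G : Graph n) → ∀ {v} → (∀ y → y ≢ v → adj G v y ≡ true) → Isolated (complement G) v
universal-complement G {v} u y = ≡-cases y v
  (λ { refl → irrefl (complement G) y })
  (λ y≢v → trans (complement-≢ G (≢-sym y≢v)) (cong not (u y y≢v)))

universal-complement⁻ : (G : Graph n) → ∀ {v} → (∀ y → y ≢ v → adj (complement G) v y ≡ true) → Isolated G v
universal-complement⁻ G {v} u y = ≡-cases y v
  (λ { refl → irrefl G y })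
  (λ y≢v → not-injective (trans (≡-sym (complement-≢ G (≢-sym y≢v))) (u y y≢v)))

prime-complement : (H : Graph m) → IsPrime H → IsPrime (complement H)
prime-complement H (4≤m , triv) = 4≤m , λ M mM → triv M (module-complement⁻ H M mM)

extension-complement : (G : Graph n) → HasPrimeExtension G p → HasPrimeExtension (complement G) p
extension-complement {n} {p} G (H , ext , prime) = complement H , ext' , prime-complement H prime
  where
  ext' : IsExtension p (complement G) (complement H)
  ext' x y = ≡-cases x y
    (λ { refl → trans (irrefl (complement H) (x ↑ˡ p)) (≡-sym (irrefl (complement G) x)) })
    (λ x≢y → trans (complement-≢ H (λ e → x≢y (↑ˡ-injective p x y e)))
      (trans (cong not (ext x y)) (≡-sym (complement-≢ G x≢y))))

-- Proved separately from `extension-complement` because a double complement agrees with the graph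
-- only pointwise.
extension-complement⁻ : (G : Graph n) → HasPrimeExtension (complement G) p → HasPrimeExtension G p
extension-complement⁻ {n} {p} G (H , ext , prime) = complement H , ext' , prime-complement H prime
  where
  ext' : IsExtension p G (complement H)
  ext' x y = ≡-cases x y
    (λ { refl → trans (irrefl (complement H) (x ↑ˡ p)) (≡-sym (irrefl G x)) })
    (λ x≢y → trans (complement-≢ H (λ e → x≢y (↑ˡ-injective p x y e)))
      (trans (cong not (trans (ext x y) (complement-≢ G x≢y))) (not-involutive (adj G x y))))

primeBound-complement⁻ : (G : Graph n) → IsPrimeBound (complement G) m → IsPrimeBound G m
primeBound-complement⁻ G (has , least) =
  extension-complement⁻ G has , λ p p<m ext → least p p<m (extension-complement G ext)

-- Graphs with 2 ^ k isolated vertices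

-- In a prime extension the isolated vertices have distinct nonempty traces on the p new vertices, so there are fewer than 2 ^ p of them.
isolated-no-extension : (G : Graph n) → ι G ≡ 2 ^ k → p ≤ k → ¬ HasPrimeExtension G p
isolated-no-extension {n} {k} {p} G ι≡ p≤k (H , ext , 4≤ , triv) =
  <⇒≱ (≤-<-trans count (<-≤-trans (pred<2^ p) (^-monoʳ-≤ 2 p≤k)))
    (≤-reflexive (trans (≡-sym ι≡) (ι≡∣isolatedSet∣ G)))
  where
  pred<2^ : ∀ p → pred (2 ^ p) < 2 ^ p
  pred<2^ p = ≤-reflexive (suc-pred (2 ^ p) ⦃ m^n≢0 2 p ⦄)

  not-two : ∀ v w → ¬ (∀ z → z ≡ v ⊎ z ≡ w)
  not-two v w h = <⇒≱ (≤-trans (s≤s (s≤s (s≤s z≤n))) 4≤) (subst (_≤ 2) (∣⊤∣≡n (n + p))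
    (∣∣≤ fullˢ f 2 (λ {z} _ → f<2 z) (λ {y} {z} _ _ → f-inj y z)))
    where
    f : Fin (n + p) → ℕ
    f z = if does (z ≟ v) then 0 else 1
    f<2 : ∀ z → f z < 2
    f<2 z with z ≟ v
    ... | yes _ = s≤s z≤n
    ... | no _  = ≤-refl
    f-inj : ∀ y z → f y ≡ f z → y ≡ z
    f-inj y z e with y ≟ v | z ≟ v | h y | h z
    ... | yes refl | yes refl | _         | _         = refl
    ... | no y≢    | no z≢    | inj₂ refl | inj₂ refl = refl
    ... | no y≢    | no z≢    | inj₁ y≡   | _         = contradiction y≡ y≢
    ... | no y≢    | no z≢    | inj₂ _    | inj₁ z≡   = contradiction z≡ z≢

  no-twins : ∀ {v w} → Twin H v w → v ≡ w
  no-twins {v} {w} t = conclude (triv ⟪ pair? ⟫ pair-module)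
    where
    pair? : Decidable (λ z → z ≡ v ⊎ z ≡ w)
    pair? z = (z ≟ v) ⊎-dec (z ≟ w)
    agree : ∀ {u x} → u ≢ v → u ≢ w → x ≡ v ⊎ x ≡ w → adj H u x ≡ adj H u v
    agree u≢v u≢w (inj₁ refl) = refl
    agree u≢v u≢w (inj₂ refl) = ≡-sym (t _ u≢v u≢w)
    pair-module : IsModule H ⟪ pair? ⟫
    pair-module u u∉ x y x∈ y∈ =
      trans (agree u≢v u≢w (∈⟪⟫⁻ pair? x∈)) (≡-sym (agree u≢v u≢w (∈⟪⟫⁻ pair? y∈)))
      where
      u≢v : u ≢ v
      u≢v e = u∉ (∈⟪⟫⁺ pair? (inj₁ e))
      u≢w : u ≢ w
      u≢w e = u∉ (∈⟪⟫⁺ pair? (inj₂ e))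
    v∈ : v ∈ ⟪ pair? ⟫
    v∈ = ∈⟪⟫⁺ pair? (inj₁ refl)
    w∈ : w ∈ ⟪ pair? ⟫
    w∈ = ∈⟪⟫⁺ pair? (inj₂ refl)
    conclude : IsTrivialModule ⟪ pair? ⟫ → v ≡ w
    conclude (inj₁ e)              = contradiction (subst (v ∈_) e v∈) ∉⊥
    conclude (inj₂ (inj₁ e))       = ⊥-elim (not-two v w λ z → ∈⟪⟫⁻ pair? (subst (z ∈_) (≡-sym e) ∈⊤))
    conclude (inj₂ (inj₂ (x , e))) =
      trans (x∈⁅y⁆⇒x≡y x (subst (v ∈_) e v∈)) (≡-sym (x∈⁅y⁆⇒x≡y x (subst (w ∈_) e w∈)))

  not-isolated : ∀ {v} → ¬ Isolated H v
  not-isolated {v} iso = conclude (triv ⟪ rest? ⟫ rest-module)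
    where
    rest? : Decidable (λ z → z ≢ v)
    rest? z = ¬? (z ≟ v)
    rest-module : IsModule H ⟪ rest? ⟫
    rest-module u u∉ x y _ _ with u ≟ v
    ... | yes refl = trans (iso x) (≡-sym (iso y))
    ... | no u≢v   = contradiction (∈⟪⟫⁺ rest? u≢v) u∉
    conclude : ¬ IsTrivialModule ⟪ rest? ⟫
    conclude (inj₁ e) = not-two v v λ z → inj₁ (decidable-stable (z ≟ v) λ z≢v →
      ∉⊥ (subst (z ∈_) e (∈⟪⟫⁺ rest? z≢v)))
    conclude (inj₂ (inj₁ e)) = ∈⟪⟫⁻ rest? (subst (v ∈_) (≡-sym e) ∈⊤) refl
    conclude (inj₂ (inj₂ (x , e))) = not-two v x λ z →
      ≡-cases z v inj₁ (λ z≢v → inj₂ (x∈⁅y⁆⇒x≡y x (subst (z ∈_) e (∈⟪⟫⁺ rest? z≢v))))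

  trace : Fin n → Fin p → Bool
  trace v q = adj H (v ↑ˡ p) (n ↑ʳ q)

  old-nonadjacent : ∀ {v} → Isolated G v → ∀ y → adj H (v ↑ˡ p) (y ↑ˡ p) ≡ false
  old-nonadjacent {v} iso y = trans (ext v y) (iso y)

  trace-injective : ∀ {v w} → Isolated G v → Isolated G w → (∀ q → trace v q ≡ trace w q) → v ≡ w
  trace-injective {v} {w} iv iw h = ↑ˡ-injective p v w (no-twins λ u _ _ → agree u (old⊎new u))
    where
    agree : ∀ u → (∃ λ x → u ≡ x ↑ˡ p) ⊎ (∃ λ q → u ≡ n ↑ʳ q) → adj H u (v ↑ˡ p) ≡ adj H u (w ↑ˡ p)
    agree u (inj₁ (y , refl)) = trans (sym H u (v ↑ˡ p)) (trans (old-nonadjacent iv y)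
      (trans (≡-sym (old-nonadjacent iw y)) (sym H (w ↑ˡ p) u)))
    agree u (inj₂ (q , refl)) = trans (sym H u (v ↑ˡ p)) (trans (h q) (sym H (w ↑ˡ p) u))

  trace-nonempty : ∀ {v} → Isolated G v → code (trace v) ≢ 0
  trace-nonempty {v} iv e = not-isolated {v ↑ˡ p} λ u → empty u (old⊎new u)
    where
    empty : ∀ u → (∃ λ x → u ≡ x ↑ˡ p) ⊎ (∃ λ q → u ≡ n ↑ʳ q) → adj H (v ↑ˡ p) u ≡ false
    empty u (inj₁ (y , refl)) = old-nonadjacent iv y
    empty u (inj₂ (q , refl)) = code-injective (trace v) (const false)
      (trans e (≡-sym (code-false {p} (const false) λ _ → refl))) q

  count : ∣ isolatedSet G ∣ ≤ pred (2 ^ p)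
  -- The code 0 is excluded by `trace-nonempty`, so shifting down by one stays injective and saves
  -- one value in the bound.
  count = ∣∣≤ (isolatedSet G) (λ v → pred (code (trace v))) (pred (2 ^ p))
    (λ {v} v∈ → pred-mono-< ⦃ ≢-nonZero (trace-nonempty (∈isolated⁻ G v∈)) ⦄ (code< (trace v)))
    (λ {v} {w} v∈ w∈ e → trace-injective (∈isolated⁻ G v∈) (∈isolated⁻ G w∈)
      (code-injective (trace v) (trace w) (pred-injective
        ⦃ ≢-nonZero (trace-nonempty (∈isolated⁻ G v∈)) ⦄ ⦃ ≢-nonZero (trace-nonempty (∈isolated⁻ G w∈)) ⦄ e)))

-- The vertex count `m` is kept general so that the equation can be matched; in the use below the
-- two sums agree only up to associativity.
extension-cast : (G : Graph n) (e : m ≡ n + p) (H : Graph m) →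
  (∀ x y → adj H (cast (≡-sym e) (x ↑ˡ p)) (cast (≡-sym e) (y ↑ˡ p)) ≡ adj G x y) → IsPrime H → HasPrimeExtension G p
extension-cast {p = p} G refl H h prime = H
  , (λ x y → trans (cong₂ (adj H) (≡-sym (cast-is-id refl (x ↑ˡ p))) (≡-sym (cast-is-id refl (y ↑ˡ p)))) (h x y)) , prime

extension-trans : (G : Graph n) (G' : Graph (n + 1)) → IsExtension 1 G G' → HasPrimeExtension G' k → HasPrimeExtension G (suc k)
extension-trans {n} {k} G G' ext (H , ext' , prime) = extension-cast G e H
    (λ x y → trans (cong₂ (adj H) (pos x) (pos y)) (trans (ext' (x ↑ˡ 1) (y ↑ˡ 1)) (ext x y))) prime
  where
  e : n + 1 + k ≡ n + suc k
  e = +-assoc n 1 k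
  pos : ∀ (x : Fin n) → cast (≡-sym e) (x ↑ˡ suc k) ≡ (x ↑ˡ 1) ↑ˡ k
  pos x = toℕ-injective (trans (toℕ-cast (≡-sym e) (x ↑ˡ suc k)) (trans (toℕ-↑ˡ x (suc k))
    (≡-sym (trans (toℕ-↑ˡ (x ↑ˡ 1) k) (toℕ-↑ˡ x 1)))))

-- Joining one new vertex to all isolated vertices keeps the twin classes but leaves no isolated vertex, so k further vertices suffice.
isolated-extension : (G : Graph n) → 1 ≤ k → (∀ v → ∣ cls G v ∣ ≤ 2 ^ k) → ι G ≡ 2 ^ k → HasPrimeExtension G (suc k)
isolated-extension {n} {k} G 1≤k cls≤ ι≡ = extension-trans G G' (glue-old G N)
    (Extend.prime-extension G' k 1≤k cls'≤ (i₀ ↑ˡ 1) i₀-full i₀-stable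
      (λ v _ → no-isolated v) no-universal)
  where
  N : Fin n → Fin 1 → Bool
  N x _ = does (isolated? G x)

  G' : Graph (n + 1)
  G' = glue G N

  z : Fin (n + 1)
  z = n ↑ʳ zero

  view : (u : Fin (n + 1)) → (∃ λ x → u ≡ x ↑ˡ 1) ⊎ u ≡ z
  view u with old⊎new {n} u
  ... | inj₁ x             = inj₁ x
  ... | inj₂ (zero , refl) = inj₂ refl

  I : Subset n
  I = isolatedSet G

  ∣I∣≡ : ∣ I ∣ ≡ 2 ^ k
  ∣I∣≡ = trans (≡-sym (ι≡∣isolatedSet∣ G)) ι≡

  two : Two I
  two = 2≤⇒Two I (≤-trans (2≤2^ 1≤k) (≤-reflexive (≡-sym ∣I∣≡)))

  i₀ : Fin n
  i₀ = proj₁ two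

  i₀-isolated : Isolated G i₀
  i₀-isolated = ∈isolated⁻ G (proj₁ (proj₂ (proj₂ two)))

  other : ∀ x → ∃ λ i → i ∈ I × i ≢ x
  other = Two⇒other I two

  isolated-z : ∀ {i} → Isolated G i → adj G' (i ↑ˡ 1) z ≡ true
  isolated-z {i} iso = trans (glue-old-new G N i zero) (dec-true (isolated? G i) iso)

  isolated-old : ∀ {i} → Isolated G i → ∀ y → adj G' (i ↑ˡ 1) (y ↑ˡ 1) ≡ false
  isolated-old {i} iso y = trans (glue-old G N i y) (iso y)

  ↑ˡ-≢ : ∀ {x y : Fin n} → x ≢ y → x ↑ˡ 1 ≢ y ↑ˡ 1
  ↑ˡ-≢ x≢y e = x≢y (↑ˡ-injective 1 _ _ e)

  -- An isolated vertex of `G` other than x sees `z` but not x.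
  z-no-twin : ∀ x → ¬ Twin G' (x ↑ˡ 1) z
  z-no-twin x t = conclude (other x)
    where
    conclude : ¬ (∃ λ i → i ∈ I × i ≢ x)
    conclude (i , i∈ , i≢x) = contradiction
      (trans (≡-sym (isolated-z (∈isolated⁻ G i∈))) (trans
        (≡-sym (t (i ↑ˡ 1) (↑ˡ-≢ i≢x) (old≢new i zero)))
        (isolated-old (∈isolated⁻ G i∈) x))) λ ()

  twin-restrict : ∀ {x y} → Twin G' (x ↑ˡ 1) (y ↑ˡ 1) → Twin G x y
  twin-restrict {x} {y} t v v≢x v≢y = trans (≡-sym (glue-old G N v x))
    (trans (t (v ↑ˡ 1) (↑ˡ-≢ v≢x) (↑ˡ-≢ v≢y)) (glue-old G N v y))

  twin-z : ∀ {u} → Twin G' u z → u ≡ z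
  twin-z {u} t with view u
  ... | inj₂ u≡z        = u≡z
  ... | inj₁ (x , refl) = contradiction t (z-no-twin x)

  ∣cls-z∣≤1 : ∣ cls G' z ∣ ≤ 1
  ∣cls-z∣≤1 = ∣∣≤ (cls G' z) (const 0) 1 (λ _ → ≤-refl)
    (λ u∈ v∈ _ → trans (twin-z (∈cls⁻ G' u∈)) (≡-sym (twin-z (∈cls⁻ G' v∈))))

  twin-old : ∀ {u x} → Twin G' u (x ↑ˡ 1) → ∃ λ y → u ≡ y ↑ˡ 1 × Twin G y x
  twin-old {u} {x} t with view u
  ... | inj₁ (y , refl) = y , refl , twin-restrict t
  ... | inj₂ refl       = contradiction (twin-sym G' t) (z-no-twin x)

  cls'≤-old : ∀ x → ∣ cls G' (x ↑ˡ 1) ∣ ≤ ∣ cls G x ∣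
  cls'≤-old x = ∣∣≤ (cls G' (x ↑ˡ 1)) f ∣ cls G x ∣ bound inj
    where
    f : Fin (n + 1) → ℕ
    -- The default 0 belongs to `z`, which is not in the class of an old vertex.
    f u = [ rank (cls G x) , const 0 ]′ (splitAt n u)
    f-old : ∀ y → f (y ↑ˡ 1) ≡ rank (cls G x) y
    f-old y = cong [ rank (cls G x) , const 0 ]′ (splitAt-↑ˡ n y 1)
    bound : ∀ {u} → u ∈ cls G' (x ↑ˡ 1) → f u < ∣ cls G x ∣
    bound u∈ with twin-old (∈cls⁻ G' u∈)
    ... | y , refl , t = ≤-<-trans (≤-reflexive (f-old y)) (rank< (cls G x) (∈cls⁺ G t))
    inj : ∀ {u v} → u ∈ cls G' (x ↑ˡ 1) → v ∈ cls G' (x ↑ˡ 1) → f u ≡ f v → u ≡ v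
    inj u∈ v∈ e with twin-old (∈cls⁻ G' u∈) | twin-old (∈cls⁻ G' v∈)
    ... | y , refl , t | y' , refl , t' = cong (_↑ˡ 1) (rank-injective (cls G x) (∈cls⁺ G t) (∈cls⁺ G t')
            (trans (≡-sym (f-old y)) (trans e (f-old y'))))

  cls'≤ : ∀ v → ∣ cls G' v ∣ ≤ 2 ^ k
  cls'≤ v with view v
  ... | inj₁ (x , refl) = ≤-trans (cls'≤-old x) (cls≤ x)
  ... | inj₂ refl       = ≤-trans ∣cls-z∣≤1 (≤-trans (s≤s z≤n) (2≤2^ 1≤k))

  isolated-twins : ∀ {i j} → Isolated G i → Isolated G j → Twin G' (i ↑ˡ 1) (j ↑ˡ 1)
  isolated-twins {i} {j} ii ij v _ _ = trans (sym G' v (i ↑ˡ 1)) (trans (agree (view v)) (sym G' (j ↑ˡ 1) v))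
    where
    agree : (∃ λ x → v ≡ x ↑ˡ 1) ⊎ v ≡ z → adj G' (i ↑ˡ 1) v ≡ adj G' (j ↑ˡ 1) v
    agree (inj₁ (y , refl)) = trans (isolated-old ii y) (≡-sym (isolated-old ij y))
    agree (inj₂ refl)       = trans (isolated-z ii) (≡-sym (isolated-z ij))

  i₀-full : ∣ cls G' (i₀ ↑ˡ 1) ∣ ≡ 2 ^ k
  i₀-full = ≤-antisym (cls'≤ (i₀ ↑ˡ 1)) (≤-trans (≤-reflexive (≡-sym ∣I∣≡))
    (∣∣≤ I (λ x → rank (cls G' (i₀ ↑ˡ 1)) (x ↑ˡ 1)) _
      (λ i∈ → rank< _ (member i∈))
      (λ i∈ j∈ e → ↑ˡ-injective 1 _ _ (rank-injective _ (member i∈) (member j∈) e))))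
    where
    member : ∀ {i} → i ∈ I → i ↑ˡ 1 ∈ cls G' (i₀ ↑ˡ 1)
    member i∈ = ∈cls⁺ G' (isolated-twins (∈isolated⁻ G i∈) i₀-isolated)

  i₀-stable : ∀ c → Twin G' c (i₀ ↑ˡ 1) → adj G' (i₀ ↑ˡ 1) c ≡ false
  i₀-stable c t with twin-old t
  ... | y , refl , _ = isolated-old i₀-isolated y

  no-isolated : ∀ v → ¬ Isolated G' v
  no-isolated v iso with view v
  ... | inj₁ (x , refl) = contradiction
          (trans (≡-sym (isolated-z λ y → trans (≡-sym (glue-old G N x y)) (iso (y ↑ˡ 1)))) (iso z)) λ ()
  ... | inj₂ refl       = contradiction
          (trans (≡-sym (isolated-z i₀-isolated)) (trans (sym G' (i₀ ↑ˡ 1) z) (iso (i₀ ↑ˡ 1)))) λ ()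

  -- The vertex `z` may be universal, but its class is a singleton and not full. An old vertex
  -- misses some isolated vertex of `G`.
  no-universal : ∀ v → ∣ cls G' v ∣ ≡ 2 ^ k → ¬ (∀ y → y ≢ v → adj G' v y ≡ true)
  no-universal v fl univ with view v
  ... | inj₂ refl       = <⇒≱ (2≤2^ 1≤k) (≤-trans (≤-reflexive (≡-sym fl)) ∣cls-z∣≤1)
  ... | inj₁ (x , refl) = conclude (other x)
    where
    conclude : ¬ (∃ λ i → i ∈ I × i ≢ x)
    conclude (i , i∈ , i≢x) = contradiction (trans (≡-sym (univ (i ↑ˡ 1) (↑ˡ-≢ i≢x)))
      (trans (sym G' (x ↑ˡ 1) (i ↑ˡ 1)) (isolated-old (∈isolated⁻ G i∈) x))) λ ()

isolated-primeBound : (G : Graph n) → 1 ≤ k → (∀ v → ∣ cls G v ∣ ≤ 2 ^ k) → ι G ≡ 2 ^ k → IsPrimeBound G (suc k)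
isolated-primeBound G 1≤k cls≤ ι≡ = isolated-extension G 1≤k cls≤ ι≡ , λ p p<1+k → isolated-no-extension G ι≡ (≤-pred p<1+k)

-- Graphs without 2 ^ k isolated or universal vertices

stable-extension : (G : Graph n) → 1 ≤ k → (∀ v → ∣ cls G v ∣ ≤ 2 ^ k) →
  (∃ λ M → IsModule G M × IsStable G M × ∣ M ∣ ≡ 2 ^ k) →
  (∀ v → ∣ cls G v ∣ ≡ 2 ^ k → ¬ Isolated G v) →
  (∀ v → ∣ cls G v ∣ ≡ 2 ^ k → ¬ (∀ y → y ≢ v → adj G v y ≡ true)) → HasPrimeExtension G k
stable-extension {n} {k} G 1≤k cls≤ (M , mM , sM , ∣M∣≡) no-isolated no-universal =
  from-two (2≤⇒Two M (≤-trans (2≤2^ 1≤k) (≤-reflexive (≡-sym ∣M∣≡))))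
  where
  from-two : Two M → HasPrimeExtension G k
  from-two (c₀ , c₁ , c₀∈ , c₁∈ , c₀≢c₁) =
    Extend.prime-extension G k 1≤k cls≤ c₀ full stable no-isolated no-universal
    where
    full : ∣ cls G c₀ ∣ ≡ 2 ^ k
    full = ≤-antisym (cls≤ c₀) (≤-trans (≤-reflexive (≡-sym ∣M∣≡))
      (p⊆q⇒∣p∣≤∣q∣ λ c∈ → ∈cls⁺ G (stable-twin G M mM sM c∈ c₀∈)))
    stable : ∀ c → Twin G c c₀ → adj G c₀ c ≡ false
    stable c t with c ≟ c₀
    ... | yes refl = irrefl G c
    -- The class of `c₀` might be a clique a priori; the second member `c₁` of `M` is a twin of c
    -- that `c₀` does not see.
    ... | no c≢c₀  = trans (twin-trans G t (stable-twin G M mM sM c₀∈ c₁∈) c₀ (≢-sym c≢c₀) c₀≢c₁) (sM c₀ c₁ c₀∈ c₁∈)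

theorem3 : ∀ {n} (G : Graph n) (k a w : ℕ) → 1 ≤ k →
    IsModularStabilityNumber G a → IsModularCliqueNumber G w →
    a ⊔ w ≡ 2 ^ k →
    IsPrimeBound G (suc k) ⇔ ((ι G ≡ 2 ^ k) ⊎ (ι (complement G) ≡ 2 ^ k))
theorem3 {n} G k a w 1≤k ((A , mA , sA , ∣A∣≡) , α≤) ((W , mW , cW , ∣W∣≡) , ω≤) max≡ = mk⇔ to from
  where
  cls≤ : ∀ v → ∣ cls G v ∣ ≤ 2 ^ k
  cls≤ v with cls-clique⊎stable G v
  ... | inj₁ clique = ≤-trans (ω≤ _ (cls-module G v) clique) (≤-trans (m≤n⊔m a w) (≤-reflexive max≡))
  ... | inj₂ stable = ≤-trans (α≤ _ (cls-module G v) stable) (≤-trans (m≤m⊔n a w) (≤-reflexive max≡))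

  clsᶜ≤ : ∀ v → ∣ cls (complement G) v ∣ ≤ 2 ^ k
  clsᶜ≤ v = ≤-trans (≤-reflexive (cong ∣_∣ (cls-complement G v))) (cls≤ v)

  from : (ι G ≡ 2 ^ k) ⊎ (ι (complement G) ≡ 2 ^ k) → IsPrimeBound G (suc k)
  from (inj₁ ι≡)  = isolated-primeBound G 1≤k cls≤ ι≡
  from (inj₂ ιᶜ≡) = primeBound-complement⁻ G (isolated-primeBound (complement G) 1≤k clsᶜ≤ ιᶜ≡)

  k-extension : ι G ≢ 2 ^ k → ι (complement G) ≢ 2 ^ k → HasPrimeExtension G k
  -- The maximum is attained by a stable module or by a clique module; the latter becomes stable in
  -- the complement.
  k-extension ι≢ ιᶜ≢ with ⊔-sel a w
  ... | inj₁ a≡ = stable-extension G 1≤k cls≤ (A , mA , sA , trans ∣A∣≡ (trans (≡-sym a≡) max≡))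
        (λ v full iso → ι≢ (trans (isolated-ι G iso) full))
        (λ v full univ → ιᶜ≢ (trans (isolated-ι (complement G) (universal-complement G univ))
          (trans (cong ∣_∣ (cls-complement G v)) full)))
  ... | inj₂ w≡ = extension-complement⁻ G (stable-extension (complement G) 1≤k clsᶜ≤
        (W , module-complement⁺ G W mW , clique-complement G W cW , trans ∣W∣≡ (trans (≡-sym w≡) max≡))
        (λ v full iso → ιᶜ≢ (trans (isolated-ι (complement G) iso) full))
        (λ v full univ → ι≢ (trans (isolated-ι G (universal-complement⁻ G univ))
          (trans (cong ∣_∣ (≡-sym (cls-complement G v))) full))))

  to : IsPrimeBound G (suc k) → (ι G ≡ 2 ^ k) ⊎ (ι (complement G) ≡ 2 ^ k)
  to (_ , least) with ι G ≟ⁿ 2 ^ k | ι (complement G) ≟ⁿ 2 ^ k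
  ... | yes ι≡ | _       = inj₁ ι≡
  ... | no _   | yes ιᶜ≡ = inj₂ ιᶜ≡
  -- A prime k-extension contradicts minimality of k + 1.
  ... | no ι≢  | no ιᶜ≢  = contradiction (k-extension ι≢ ιᶜ≢) (least k (n<1+n k))
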